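{- There do not exist more than $24$ complete folding curves in $\mathbb{R}^2$ which are pairwise disjoint, i.e. such that no unit lattice edge is the support of segments of two different curves among them.
   Context: All sequences take values in $\{+1,-1\}$. For $S=(a_1,\dots,a_n)$ write $\overline{S}=(-a_n,\dots,-a_1)$. The $n$-folding sequences are defined recursively: the only $0$-folding sequence is the empty sequence, and the $(n+1)$-folding sequences are exactly $(\overline{S},+1,S)$ and $(\overline{S},-1,S)$ with $S$ an $n$-folding sequence. A subword of a sequence $(b_k)$ is a block $(b_{h+1},\dots,b_{h+m})$. A complete folding sequence is a sequence $(a_k)_{k\in\mathbb{Z}}$ each finite subword of which is a subword of some $n$-folding sequence. A segment is an oriented unit edge of $\mathbb{Z}^2$. A complete curve is a sequence $(C_i)_{i\in\mathbb{Z}}$ of segments such that the terminal point of $C_i$ is the initial point of $C_{i+1}$, consecutive supports are perpendicular, and all supports are pairwise distinct (curves differing by an index shift are identified). Its associated sequence is $(\eta_i)_{i\in\mathbb{Z}}$ with $\eta_i=+1$ (resp. $-1$) if one turns left (resp. right) from $C_i$ to $C_{i+1}$. A complete folding curve is a complete curve whose associated sequence is a complete folding sequence. -}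

module Defs where

open import Data.Nat using (ℕ; zero; suc)
open import Data.Integer using (ℤ; +_; _+_; _-_)
open import Data.List using (List; []; _∷_; _++_; map; reverse)
open import Data.Product using (_×_; _,_; ∃; ∃-syntax)
open import Relation.Binary.PropositionalEquality using (_≡_; _≢_)

data Sign : Set where
  plus minus : Sign

neg : Sign → Sign
neg plus  = minus
neg minus = plus

bar : List Sign → List Sign
bar S = reverse (map neg S)

data Folding : ℕ → List Sign → Set where
  fold0 : Folding zero []
  foldS : ∀ {n S} → Folding n S → (s : Sign) → Folding (suc n) (bar S ++ s ∷ S)

Subword : List Sign → List Sign → Set
Subword w L = ∃[ p ] ∃[ q ] (L ≡ p ++ w ++ q)

window : (ℤ → Sign) → ℤ → ℕ → List Sign
window b h zero    = []
window b h (suc m) = b (h + + 1) ∷ window b (h + + 1) m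

CompleteFolding : (ℤ → Sign) → Set
CompleteFolding a = ∀ (h : ℤ) (m : ℕ) →
  ∃[ n ] ∃[ S ] (Folding n S × Subword (window a h m) S)

Point : Set
Point = ℤ × ℤ

data Dir : Set where
  E N W S : Dir

record Segment : Set where
  constructor seg
  field
    start : Point
    dir   : Dir
open Segment public

step : Dir → Point → Point
step E (x , y) = (x + + 1 , y)
step N (x , y) = (x , y + + 1)
step W (x , y) = (x - + 1 , y)
step S (x , y) = (x , y - + 1)

terminal : Segment → Point
terminal s = step (dir s) (start s)

data Axis : Set where
  horiz vert : Axis

axis : Dir → Axis
axis E = horiz
axis W = horiz
axis N = vert
axis S = vert

-- support of a segment: the unoriented unit edge, represented by its
-- lower/left endpoint together with its axis
support : Segment → Point × Axis
support (seg p E) = (p , horiz)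
support (seg p W) = (step W p , horiz)
support (seg p N) = (p , vert)
support (seg p S) = (step S p , vert)

turnLeft : Dir → Dir
turnLeft E = N
turnLeft N = W
turnLeft W = S
turnLeft S = E

-- η = +1 if one turns left from d₁ to d₂, −1 otherwise (right turn,
-- given that consecutive segments are perpendicular)
turn : Dir → Dir → Sign
turn E N = plus
turn N W = plus
turn W S = plus
turn S E = plus
turn _ _ = minus

record CompleteCurve (C : ℤ → Segment) : Set where
  field
    connected     : ∀ i → terminal (C i) ≡ start (C (i + + 1))
    perpendicular : ∀ i → axis (dir (C i)) ≢ axis (dir (C (i + + 1)))
    supportsDistinct : ∀ i j → i ≢ j → support (C i) ≢ support (C j)

associatedSequence : (ℤ → Segment) → ℤ → Sign
associatedSequence C i = turn (dir (C i)) (dir (C (i + + 1)))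

record CompleteFoldingCurve (C : ℤ → Segment) : Set where
  field
    curve   : CompleteCurve C
    folding : CompleteFolding (associatedSequence C)

Disjoint : (ℤ → Segment) → (ℤ → Segment) → Set
Disjoint C D = ∀ i j → support (C i) ≢ support (D j)

{-# OPTIONS --safe #-}
-- Cut a complete folding curve into blocks of 4ⁿ segments along its 2n-folding subwords.  A block has
-- displacement 2ⁿ along an axis, consecutive blocks have perpendicular displacements, and by induction on n
-- (a block consists of four blocks of the previous level) every vertex of a block is within 2ⁿ of one of its
-- ends, in the supremum distance.  Hence the three blocks around segment number 0 consist of 3 ⋅ 4ⁿ segments
-- within 3 ⋅ 2ⁿ of it.  For k disjoint curves whose segments number 0 are at bounded distance from the origin,
-- this puts 3k ⋅ 4ⁿ distinct edges in a square of side 6 ⋅ 2ⁿ + O(1), which has 72 ⋅ 4ⁿ + O(2ⁿ) edges.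
module Submission where

open import Defs
open import Data.Nat as ℕ using (ℕ; zero; suc; _≤_; _<_; z≤n; s≤s)
import Data.Nat.Properties as ℕₚ
open import Data.Nat.Tactic.RingSolver renaming (solve-∀ to solve-∀ⁿ)
open import Data.Integer as ℤ using (ℤ; +_; ∣_∣)
import Data.Integer.Properties as ℤₚ
open import Data.Integer.Tactic.RingSolver using (solve-∀)
open import Data.Fin as Fin using (Fin; toℕ; fromℕ<; combine; remQuot)
import Data.Fin.Properties as Finₚ
open import Data.List using (List; []; _∷_; _++_; map; reverse; length)
import Data.List.Properties as Listₚ
open import Data.List.Relation.Unary.All as All using (All; []; _∷_)
import Data.List.Relation.Unary.All.Properties as Allₚ
open import Data.Product using (_×_; _,_; ∃-syntax; proj₁; proj₂; uncurry)
open import Data.Sum using (_⊎_; inj₁; inj₂; [_,_]′)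
open import Relation.Nullary using (yes; no; contradiction)
open import Relation.Binary.PropositionalEquality using (_≡_; _≢_; refl; sym; trans; cong; cong₂; subst; module ≡-Reasoning)
import Algebra.Properties.AbelianGroup

private module +-Group = Algebra.Properties.AbelianGroup ℤₚ.+-0-abelianGroup

-- Reversal of sign sequences

neg-involutive : ∀ s → neg (neg s) ≡ s
neg-involutive plus  = refl
neg-involutive minus = refl

bar-involutive : ∀ L → bar (bar L) ≡ L
bar-involutive L = begin
  reverse (map neg (reverse (map neg L)))  ≡⟨ cong reverse (Listₚ.reverse-map neg (map neg L)) ⟩
  reverse (reverse (map neg (map neg L)))  ≡⟨ Listₚ.reverse-involutive _ ⟩
  map neg (map neg L)                      ≡⟨ Listₚ.map-∘ L ⟨
  map (λ s → neg (neg s)) L                ≡⟨ Listₚ.map-cong neg-involutive L ⟩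
  map (λ s → s) L                          ≡⟨ Listₚ.map-id L ⟩
  L                                        ∎
  where open ≡-Reasoning

bar-++-∷ : ∀ L s M → bar (L ++ s ∷ M) ≡ bar M ++ neg s ∷ bar L
bar-++-∷ L s M = begin
  reverse (map neg (L ++ s ∷ M))                       ≡⟨ cong reverse (Listₚ.map-++ neg L (s ∷ M)) ⟩
  reverse (map neg L ++ neg s ∷ map neg M)             ≡⟨ Listₚ.reverse-++ (map neg L) (neg s ∷ map neg M) ⟩
  reverse (neg s ∷ map neg M) ++ bar L                 ≡⟨ cong (_++ bar L) (Listₚ.unfold-reverse (neg s) (map neg M)) ⟩
  (bar M ++ neg s ∷ []) ++ bar L                       ≡⟨ Listₚ.++-assoc (bar M) (neg s ∷ []) (bar L) ⟩
  bar M ++ neg s ∷ bar L                               ∎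
  where open ≡-Reasoning

-- Reversal exchanges the two outer halves and negates the sign between them, so the two foldings
-- built from `L` are the reverses of each other.
bar-fold : ∀ L s → bar (bar L ++ s ∷ L) ≡ bar L ++ neg s ∷ L
bar-fold L s = trans (bar-++-∷ (bar L) s L) (cong (λ M → bar L ++ neg s ∷ M) (bar-involutive L))

length-bar : ∀ L → length (bar L) ≡ length L
length-bar L = trans (Listₚ.length-reverse (map neg L)) (Listₚ.length-map neg L)

-- Walks

turnBy : Sign → Dir → Dir
turnBy plus  d = turnLeft d
turnBy minus E = S
turnBy minus N = E
turnBy minus W = N
turnBy minus S = W

next : Sign → Segment → Segment
next s c = seg (terminal c) (turnBy s (dir c))

run : Segment → List Sign → Segment
run c []      = c
run c (s ∷ L) = run (next s c) L

-- The word lists turns, so a walk has one segment more than its word has signs; hence the many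
-- occurrences of `suc (length F)` below.
segs : Segment → List Sign → List Segment
segs c []      = c ∷ []
segs c (s ∷ L) = c ∷ segs (next s c) L

run-++ : ∀ c L M → run c (L ++ M) ≡ run (run c L) M
run-++ c []      M = refl
run-++ c (s ∷ L) M = run-++ (next s c) L M

segs-++-∷ : ∀ c L s M → segs c (L ++ s ∷ M) ≡ segs c L ++ segs (next s (run c L)) M
segs-++-∷ c []      s M = refl
segs-++-∷ c (t ∷ L) s M = cong (c ∷_) (segs-++-∷ (next t c) L s M)

turnBy-neg : ∀ s d → turnBy s (turnBy (neg s) d) ≡ d
turnBy-neg plus  E = refl
turnBy-neg plus  N = refl
turnBy-neg plus  W = refl
turnBy-neg plus  S = refl
turnBy-neg minus E = refl
turnBy-neg minus N = refl
turnBy-neg minus W = refl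
turnBy-neg minus S = refl

neg-turnBy : ∀ s d → turnBy (neg s) (turnBy s d) ≡ d
neg-turnBy plus  d = turnBy-neg minus d
neg-turnBy minus d = turnBy-neg plus d

turnBy-comm : ∀ s t d → turnBy s (turnBy t d) ≡ turnBy t (turnBy s d)
turnBy-comm plus  plus  d = refl
turnBy-comm minus minus d = refl
turnBy-comm plus  minus d = trans (turnBy-neg plus d) (sym (turnBy-neg minus d))
turnBy-comm minus plus  d = trans (turnBy-neg minus d) (sym (turnBy-neg plus d))

-- Displacements and the supremum distance

move : ℕ → Dir → Point → Point
move a E (x , y) = (x ℤ.+ + a , y)
move a N (x , y) = (x , y ℤ.+ + a)
move a W (x , y) = (x ℤ.- + a , y)
move a S (x , y) = (x , y ℤ.- + a)

step≡move : ∀ d p → step d p ≡ move 1 d p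
step≡move E p = refl
step≡move N p = refl
step≡move W p = refl
step≡move S p = refl

-- The supremum distance suits both ends of the argument: two perpendicular displacements of length
-- `a` stay within `a`, and balls are squares whose edges can be counted exactly.
record Near (r : ℕ) (p q : Point) : Set where
  constructor near
  field
    near₁ : ∣ proj₁ p ℤ.- proj₁ q ∣ ≤ r
    near₂ : ∣ proj₂ p ℤ.- proj₂ q ∣ ≤ r

near-sym : ∀ {r p q} → Near r p q → Near r q p
near-sym {r} {x , y} {x′ , y′} (near h v) =
  near (subst (_≤ r) (ℤₚ.∣i-j∣≡∣j-i∣ x x′) h) (subst (_≤ r) (ℤₚ.∣i-j∣≡∣j-i∣ y y′) v)

∣-∣-triangle : ∀ {r r′} x y z → ∣ x ℤ.- y ∣ ≤ r → ∣ y ℤ.- z ∣ ≤ r′ → ∣ x ℤ.- z ∣ ≤ r ℕ.+ r′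
∣-∣-triangle {r} {r′} x y z h h′ = begin
  ∣ x ℤ.- z ∣                      ≡⟨ cong ∣_∣ (eq x y z) ⟩
  ∣ (x ℤ.- y) ℤ.+ (y ℤ.- z) ∣      ≤⟨ ℤₚ.∣i+j∣≤∣i∣+∣j∣ (x ℤ.- y) (y ℤ.- z) ⟩
  ∣ x ℤ.- y ∣ ℕ.+ ∣ y ℤ.- z ∣      ≤⟨ ℕₚ.+-mono-≤ h h′ ⟩
  r ℕ.+ r′                         ∎
  where
  open ℕₚ.≤-Reasoning
  eq : ∀ x y z → x ℤ.- z ≡ (x ℤ.- y) ℤ.+ (y ℤ.- z)
  eq = solve-∀

near-trans : ∀ {r r′ p q u} → Near r p q → Near r′ q u → Near (r ℕ.+ r′) p u
near-trans {p = x , y} {x′ , y′} {x″ , y″} (near h v) (near h′ v′) =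
  near (∣-∣-triangle x x′ x″ h h′) (∣-∣-triangle y y′ y″ v v′)

fix-near : ∀ a x → ∣ x ℤ.- x ∣ ≤ a
fix-near a x = subst (_≤ a) (sym (cong ∣_∣ (ℤₚ.+-inverseʳ x))) z≤n

add-near : ∀ a x → ∣ x ℤ.+ + a ℤ.- x ∣ ≤ a
add-near a x = ℕₚ.≤-reflexive (cong ∣_∣ (eq x (+ a)))
  where
  eq : ∀ x b → x ℤ.+ b ℤ.- x ≡ b
  eq = solve-∀

sub-near : ∀ a x → ∣ x ℤ.- + a ℤ.- x ∣ ≤ a
sub-near a x = ℕₚ.≤-reflexive (trans (cong ∣_∣ (eq x (+ a))) (ℤₚ.∣-i∣≡∣i∣ (+ a)))
  where
  eq : ∀ x b → x ℤ.- b ℤ.- x ≡ ℤ.- b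
  eq = solve-∀

near-refl : ∀ a p → Near a p p
near-refl a (x , y) = near (fix-near a x) (fix-near a y)

near-move : ∀ a d p → Near a (move a d p) p
near-move a E (x , y) = near (add-near a x) (fix-near a y)
near-move a N (x , y) = near (fix-near a x) (add-near a y)
near-move a W (x , y) = near (sub-near a x) (fix-near a y)
near-move a S (x , y) = near (fix-near a x) (sub-near a y)

-- Perpendicular moves do not add up in the supremum distance.
near-corner : ∀ a s d p → Near a (move a (turnBy s d) (move a d p)) p
near-corner a plus  E (x , y) = near (add-near a x) (add-near a y)
near-corner a plus  N (x , y) = near (sub-near a x) (add-near a y)
near-corner a plus  W (x , y) = near (sub-near a x) (sub-near a y)
near-corner a plus  S (x , y) = near (add-near a x) (sub-near a y)
near-corner a minus E (x , y) = near (add-near a x) (sub-near a y)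
near-corner a minus N (x , y) = near (add-near a x) (add-near a y)
near-corner a minus W (x , y) = near (sub-near a x) (add-near a y)
near-corner a minus S (x , y) = near (sub-near a x) (sub-near a y)

-- The net direction of a walk with directions x, s⁻¹x, ts⁻¹x, tx.
net : Sign → Sign → Dir → Dir
net plus  plus  x = x
net minus minus x = x
net plus  minus x = turnBy minus x
net minus plus  x = turnBy plus x

-- Among the four directions two are opposite and cancel, while the other two are equal and add up
-- to a move of length `a + a`.
net-move : ∀ a s t x p →
  move a (turnBy t x) (move a (turnBy t (turnBy (neg s) x)) (move a (turnBy (neg s) x) (move a x p)))
    ≡ move (a ℕ.+ a) (net s t x) p
net-move a s t x (u , v) = lemma s t x
  where
  lemma : ∀ s t x →
    move a (turnBy t x) (move a (turnBy t (turnBy (neg s) x)) (move a (turnBy (neg s) x) (move a x (u , v))))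
      ≡ move (a ℕ.+ a) (net s t x) (u , v)
  add₂ : ∀ x → x ℤ.+ + a ℤ.+ + a ≡ x ℤ.+ + (a ℕ.+ a)
  add₂ x = ℤₚ.+-assoc x (+ a) (+ a)
  sub₂ : ∀ x → x ℤ.- + a ℤ.- + a ≡ x ℤ.- + (a ℕ.+ a)
  sub₂ x = trans (ℤₚ.+-assoc x _ _) (cong (λ b → x ℤ.+ b) (sym (ℤₚ.neg-distrib-+ (+ a) (+ a))))
  add-sub : ∀ x → x ℤ.+ + a ℤ.- + a ≡ x
  add-sub x = eq x (+ a) where
    eq : ∀ x b → x ℤ.+ b ℤ.- b ≡ x
    eq = solve-∀
  sub-add : ∀ x → x ℤ.- + a ℤ.+ + a ≡ x
  sub-add x = eq x (+ a) where
    eq : ∀ x b → x ℤ.- b ℤ.+ b ≡ x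
    eq = solve-∀
  lemma plus  plus  E = cong₂ _,_ (add₂ u) (sub-add v)
  lemma plus  plus  N = cong₂ _,_ (add-sub u) (add₂ v)
  lemma plus  plus  W = cong₂ _,_ (sub₂ u) (add-sub v)
  lemma plus  plus  S = cong₂ _,_ (sub-add u) (sub₂ v)
  lemma minus minus E = cong₂ _,_ (add₂ u) (add-sub v)
  lemma minus minus N = cong₂ _,_ (sub-add u) (add₂ v)
  lemma minus minus W = cong₂ _,_ (sub₂ u) (sub-add v)
  lemma minus minus S = cong₂ _,_ (add-sub u) (sub₂ v)
  lemma plus  minus E = cong₂ _,_ (add-sub u) (sub₂ v)
  lemma plus  minus N = cong₂ _,_ (add₂ u) (add-sub v)
  lemma plus  minus W = cong₂ _,_ (sub-add u) (add₂ v)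
  lemma plus  minus S = cong₂ _,_ (sub₂ u) (sub-add v)
  lemma minus plus  E = cong₂ _,_ (add-sub u) (add₂ v)
  lemma minus plus  N = cong₂ _,_ (sub₂ u) (add-sub v)
  lemma minus plus  W = cong₂ _,_ (sub-add u) (sub₂ v)
  lemma minus plus  S = cong₂ _,_ (add₂ u) (sub-add v)

net-turnBy : ∀ s t r x → net s t (turnBy r x) ≡ turnBy r (net s t x)
net-turnBy plus  plus  r x = refl
net-turnBy minus minus r x = refl
net-turnBy plus  minus r x = turnBy-comm minus r x
net-turnBy minus plus  r x = turnBy-comm plus r x

-- Provides the compatibility `f∘ē` of `Dual` for the arcs of the next level.
net-neg : ∀ s t x → net s t (turnBy (neg t) x) ≡ net s (neg t) x
net-neg plus  plus  x = refl
net-neg minus minus x = refl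
net-neg plus  minus x = turnBy-neg minus x
net-neg minus plus  x = turnBy-neg plus x

-- Arcs and their reversals

-- The invariant of the induction on levels. `near-end` speaks of initial points of segments only;
-- the one remaining vertex is the end of the walk itself.
record Arc (a : ℕ) (L : List Sign) (exit span : Dir → Dir) : Set where
  field
    exit-dir : ∀ c → dir (run c L) ≡ exit (dir c)
    endpoint : ∀ c → terminal (run c L) ≡ move a (span (dir c)) (start c)
    near-end : ∀ c → All (λ q → Near a (start q) (start c) ⊎ Near a (start q) (terminal (run c L))) (segs c L)
open Arc

Equivariant : (Dir → Dir) → Set
Equivariant f = ∀ s d → f (turnBy s d) ≡ turnBy s (f d)

-- M plays the role of bar L, the turns of the same arc traversed backwards; e, ē are the exits and f, g the spans.
record Dual (a : ℕ) (L M : List Sign) : Set where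
  field
    {e ē f g} : Dir → Dir
    arc  : Arc a L e f
    arcᵒ : Arc a M ē g
    e∘ē  : ∀ d → e (ē d) ≡ d
    ē∘e  : ∀ d → ē (e d) ≡ d
    f∘ē  : ∀ d → f (ē d) ≡ g d
    g∘e  : ∀ d → g (e d) ≡ f d
    e-eq : Equivariant e
    ē-eq : Equivariant ē
    f-eq : Equivariant f
    g-eq : Equivariant g

dual-sym : ∀ {a L M} → Dual a L M → Dual a M L
dual-sym D = record
  { arc = arcᵒ ; arcᵒ = arc ; e∘ē = ē∘e ; ē∘e = e∘ē ; f∘ē = g∘e ; g∘e = f∘ē
  ; e-eq = ē-eq ; ē-eq = e-eq ; f-eq = g-eq ; g-eq = f-eq }
  where open Dual D

-- Base of the induction: a single segment, whose word of turns is empty and equal to its own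
-- reverse.
dual-[] : Dual 1 [] []
dual-[] = record
  { arc = trivial ; arcᵒ = trivial ; e∘ē = λ _ → refl ; ē∘e = λ _ → refl ; f∘ē = λ _ → refl
  ; g∘e = λ _ → refl ; e-eq = λ _ _ → refl ; ē-eq = λ _ _ → refl ; f-eq = λ _ _ → refl ; g-eq = λ _ _ → refl }
  where
  trivial : Arc 1 [] (λ d → d) (λ d → d)
  trivial = record
    { exit-dir = λ c → refl
    ; endpoint = λ c → step≡move (dir c) (start c)
    ; near-end = λ c → inj₁ (near-refl 1 (start c)) ∷ [] }

module _ {a L M} (D : Dual a L M) where
  open Dual D

  -- The turn between the spans of consecutive dual arcs is the turn between the arcs, so the spans are perpendicular.
  bend : ∀ c s → let c′ = next s (run c M) in
    terminal (run c′ L) ≡ move a (turnBy s (g (dir c))) (terminal (run c M))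
      × dir (run c′ L) ≡ turnBy s (dir c)
  bend c s = trans (endpoint arc c′) (cong (λ d → move a d (start c′)) span-eq) , trans (exit-dir arc c′) exit-eq
    where
    open ≡-Reasoning
    c′ = next s (run c M)
    span-eq : f (turnBy s (dir (run c M))) ≡ turnBy s (g (dir c))
    span-eq = begin
      f (turnBy s (dir (run c M)))  ≡⟨ f-eq s _ ⟩
      turnBy s (f (dir (run c M)))  ≡⟨ cong (λ d → turnBy s (f d)) (exit-dir arcᵒ c) ⟩
      turnBy s (f (ē (dir c)))      ≡⟨ cong (turnBy s) (f∘ē (dir c)) ⟩
      turnBy s (g (dir c))          ∎
    exit-eq : e (turnBy s (dir (run c M))) ≡ turnBy s (dir c)
    exit-eq = begin
      e (turnBy s (dir (run c M)))  ≡⟨ e-eq s _ ⟩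
      turnBy s (e (dir (run c M)))  ≡⟨ cong (λ d → turnBy s (e d)) (exit-dir arcᵒ c) ⟩
      turnBy s (e (ē (dir c)))      ≡⟨ cong (turnBy s) (e∘ē (dir c)) ⟩
      turnBy s (dir c)              ∎

  bend-near : ∀ c s → Near a (terminal (run (next s (run c M)) L)) (start c)
  bend-near c s rewrite proj₁ (bend c s) | endpoint arcᵒ c = near-corner a s (g (dir c)) (start c)

arc-near : ∀ {a L e f} → Arc a L e f → ∀ c → Near a (terminal (run c L)) (start c)
arc-near {a} {f = f} A c rewrite endpoint A c = near-move a (f (dir c)) (start c)

-- Two folds applied to `L`, first with `s` and then with `t`, when `M` is `bar L`. The sign in the
-- left half is `neg s` by `bar-fold`.
quad : List Sign → List Sign → Sign → Sign → List Sign
quad L M s t = (M ++ neg s ∷ L) ++ t ∷ (M ++ s ∷ L)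

module Quad {a L M} (D : Dual a L M) (s t : Sign) where
  open Dual D
  word = quad L M s t

  module _ (c : Segment) where
    -- The four arcs follow `M`, `L`, `M`, `L` and begin with `c`, `c₁`, `c₂`, `c₃`; `x` is the
    -- direction of the first displacement.
    c₁ = next (neg s) (run c M)
    c₂ = next t (run c₁ L)
    c₃ = next s (run c₂ M)
    x  = g (dir c)

    run-word : run c word ≡ run c₃ L
    run-word
      rewrite run-++ c (M ++ neg s ∷ L) (t ∷ (M ++ s ∷ L))
            | run-++ c M (neg s ∷ L)
            | run-++ c₂ M (s ∷ L) = refl

    segs-word : segs c word ≡ (segs c M ++ segs c₁ L) ++ (segs c₂ M ++ segs c₃ L)
    segs-word
      rewrite segs-++-∷ c (M ++ neg s ∷ L) t (M ++ s ∷ L)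
            | segs-++-∷ c M (neg s) L
            | run-++ c M (neg s ∷ L)
            | segs-++-∷ c₂ M s L = refl

    dir₂ : dir c₂ ≡ turnBy t (turnBy (neg s) (dir c))
    dir₂ = cong (turnBy t) (proj₂ (bend D c (neg s)))

    span₂ : g (dir c₂) ≡ turnBy t (turnBy (neg s) x)
    span₂ = trans (cong g dir₂) (trans (g-eq t _) (cong (turnBy t) (g-eq (neg s) _)))

    turn₃ : ∀ d → turnBy s (turnBy t (turnBy (neg s) d)) ≡ turnBy t d
    turn₃ d = trans (turnBy-comm s t _) (cong (turnBy t) (turnBy-neg s d))

    -- By `bend`, an arc along `M` followed by one along `L` changes the direction only by the turn
    -- between them. The turns `neg s` and `s` cancel and `t` remains.
    exit-word : dir (run c word) ≡ turnBy t (dir c)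
    exit-word = trans (cong dir run-word) (trans (proj₂ (bend D c₂ s)) (trans (cong (turnBy s) dir₂) (turn₃ (dir c))))

    end-word : terminal (run c word) ≡ move (a ℕ.+ a) (net s t x) (start c)
    end-word = begin
      terminal (run c word)                                       ≡⟨ cong terminal run-word ⟩
      terminal (run c₃ L)                                         ≡⟨ proj₁ (bend D c₂ s) ⟩
      move a (turnBy s (g (dir c₂))) (terminal (run c₂ M))        ≡⟨ cong₂ (move a) (trans (cong (turnBy s) span₂) (turn₃ x)) (endpoint arcᵒ c₂) ⟩
      move a (turnBy t x) (move a (g (dir c₂)) (terminal (run c₁ L)))
        ≡⟨ cong₂ (λ d p → move a (turnBy t x) (move a d p)) span₂ (proj₁ (bend D c (neg s))) ⟩
      move a (turnBy t x) (move a (turnBy t (turnBy (neg s) x)) (move a (turnBy (neg s) x) (terminal (run c M))))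
        ≡⟨ cong (λ p → move a (turnBy t x) (move a (turnBy t (turnBy (neg s) x)) (move a (turnBy (neg s) x) p))) (endpoint arcᵒ c) ⟩
      move a (turnBy t x) (move a (turnBy t (turnBy (neg s) x)) (move a (turnBy (neg s) x) (move a x (start c))))
        ≡⟨ net-move a s t x (start c) ⟩
      move (a ℕ.+ a) (net s t x) (start c)                        ∎
      where open ≡-Reasoning

    -- The first three corners lie within a of the start, the last three within a of the end.
    near-word : All (λ q → Near (a ℕ.+ a) (start q) (start c) ⊎ Near (a ℕ.+ a) (start q) (terminal (run c word))) (segs c word)
    near-word rewrite segs-word | run-word =
      Allₚ.++⁺
        (Allₚ.++⁺ (All.map (λ n → inj₁ ([ close₀ , close₁ ]′ n)) (near-end arcᵒ c))
                  (All.map (λ n → inj₁ ([ close₁ , close₂ ]′ n)) (near-end arc c₁)))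
        (Allₚ.++⁺ (All.map (λ n → inj₂ ([ close₂′ , close₃ ]′ n)) (near-end arcᵒ c₂))
                  (All.map (λ n → inj₂ ([ close₃ , close₄ ]′ n)) (near-end arc c₃)))
      where
      close₀ : ∀ {q} → Near a q (start c) → Near (a ℕ.+ a) q (start c)
      close₀ n = near-trans n (near-refl a (start c))
      close₁ : ∀ {q} → Near a q (start c₁) → Near (a ℕ.+ a) q (start c)
      close₁ n = near-trans n (arc-near arcᵒ c)
      close₂ : ∀ {q} → Near a q (start c₂) → Near (a ℕ.+ a) q (start c)
      close₂ n = near-trans n (bend-near D c (neg s))
      close₂′ : ∀ {q} → Near a q (start c₂) → Near (a ℕ.+ a) q (terminal (run c₃ L))
      close₂′ n = near-trans n (near-sym (bend-near D c₂ s))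
      close₃ : ∀ {q} → Near a q (start c₃) → Near (a ℕ.+ a) q (terminal (run c₃ L))
      close₃ n = near-trans n (near-sym (arc-near arc c₃))
      close₄ : ∀ {q} → Near a q (terminal (run c₃ L)) → Near (a ℕ.+ a) q (terminal (run c₃ L))
      close₄ n = near-trans n (near-refl a (terminal (run c₃ L)))

  arc-word : Arc (a ℕ.+ a) word (turnBy t) (λ d → net s t (g d))
  arc-word = record { exit-dir = exit-word ; endpoint = end-word ; near-end = near-word }

-- When `M` is `bar L`, reversing the quad negates its central sign and changes nothing else, so
-- `Quad.arc-word` serves for both words.
dual-quad : ∀ {a L M} → Dual a L M → ∀ s t → Dual (a ℕ.+ a) (quad L M s t) (quad L M s (neg t))
dual-quad D s t = record
  { arc  = Quad.arc-word D s t
  ; arcᵒ = Quad.arc-word D s (neg t)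
  ; e∘ē  = turnBy-neg t
  ; ē∘e  = neg-turnBy t
  ; f∘ē  = λ d → trans (cong (net s t) (g-eq (neg t) d)) (net-neg s t (g d))
  -- The same computation as for `f∘ē`, with `neg t` in place of `t`; the resulting `neg (neg t)` is
  -- turned back into `t`.
  ; g∘e  = λ d → trans (cong (net s (neg t)) (trans (g-eq t d) (cong (λ r → turnBy r (g d)) (sym (neg-involutive t)))))
                       (trans (net-neg s (neg t) (g d)) (cong (λ r → net s r (g d)) (neg-involutive t)))
  ; e-eq = λ r d → turnBy-comm t r d
  ; ē-eq = λ r d → turnBy-comm (neg t) r d
  ; f-eq = λ r d → trans (cong (net s t) (g-eq r d)) (net-turnBy s t r (g d))
  ; g-eq = λ r d → trans (cong (net s (neg t)) (g-eq r d)) (net-turnBy s (neg t) r (g d))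
  }
  where open Dual D

triple : List Sign → List Sign → Sign → Sign → List Sign
triple L M u v = L ++ u ∷ M ++ v ∷ L

-- Relative to the two ends of the middle edge, the four corners of three consecutive edges are at distance at most a.
triple-near : ∀ {a L M} → Dual a L M → ∀ c u v →
  All (λ p → All (λ q → Near (3 ℕ.* a) (start p) (start q)) (segs c (triple L M u v)))
      (segs (run c (L ++ u ∷ [])) M)
triple-near {a} {L} {M} D c u v
  rewrite segs-++-∷ c L u (M ++ v ∷ L)
        | run-++ c L (u ∷ [])
        | segs-++-∷ (next u (run c L)) M v L
  = All.map (λ n → All.map (join n) corners) (near-end arcᵒ c₁)
  where
  open Dual D
  open Arc
  c₁ = next u (run c L)
  c₂ = next v (run c₁ M)
  A₀ = start c₁
  B₀ = terminal (run c₁ M)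

  BothNear : Point → Set
  BothNear q = Near (a ℕ.+ a) A₀ q × Near (a ℕ.+ a) B₀ q

  both : ∀ {p q} → Near a A₀ p → Near a B₀ p → Near a q p → BothNear q
  both nA nB n = near-trans nA (near-sym n) , near-trans nB (near-sym n)

  both-c : ∀ {q} → Near a q (start c) → BothNear q
  both-c = both (arc-near arc c) (bend-near (dual-sym D) c u)
  both-A : ∀ {q} → Near a q A₀ → BothNear q
  both-A = both (near-refl a A₀) (arc-near arcᵒ c₁)
  both-B : ∀ {q} → Near a q B₀ → BothNear q
  both-B = both (near-sym (arc-near arcᵒ c₁)) (near-refl a B₀)
  both-e : ∀ {q} → Near a q (terminal (run c₂ L)) → BothNear q
  both-e = both (near-sym (bend-near D c₁ v)) (near-sym (arc-near arc c₂))

  corners : All (λ q → BothNear (start q)) (segs c L ++ segs c₁ M ++ segs c₂ L)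
  corners = Allₚ.++⁺ (All.map [ both-c , both-A ]′ (near-end arc c))
    (Allₚ.++⁺ (All.map [ both-A , both-B ]′ (near-end arcᵒ c₁))
              (All.map [ both-B , both-e ]′ (near-end arc c₂)))

  a+2a : a ℕ.+ (a ℕ.+ a) ≡ 3 ℕ.* a
  a+2a = cong (λ b → a ℕ.+ (a ℕ.+ b)) (sym (ℕₚ.+-identityʳ a))

  -- A vertex of the middle arc is within `a` of `A₀` or of `B₀`. Since `q` is within `a + a` of
  -- both, either case gives `3a`.
  join : ∀ {p q} → Near a p A₀ ⊎ Near a p B₀ → BothNear q → Near (3 ℕ.* a) p q
  join {p} {q} n (nA , nB) = subst (λ r → Near r p q) a+2a
    ([ (λ m → near-trans m nA) , (λ m → near-trans m nB) ]′ n)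

-- Folding words

-- Only at even levels do blocks have a displacement along an axis. The recursive form lets a match
-- on `Folding (double n)` expose two folds at once.
double : ℕ → ℕ
double zero    = zero
double (suc n) = suc (suc (double n))

-- Two folds turn one arc into four and double its displacement, which gives `2 ^ n` at level
-- `double n`.
folding-dual : ∀ n {L} → Folding (double n) L → Dual (2 ℕ.^ n) L (bar L)
folding-dual zero fold0 = dual-[]
folding-dual (suc n) (foldS (foldS {S = L} F s) t)
  rewrite bar-fold (bar L ++ s ∷ L) t | bar-fold L s =
  subst (λ a → Dual a (quad L (bar L) s t) (quad L (bar L) s (neg t)))
    (cong (2 ℕ.^ n ℕ.+_) (sym (ℕₚ.+-identityʳ (2 ℕ.^ n))))
    (dual-quad (folding-dual n F) s t)

folding-length : ∀ {n L} → Folding n L → suc (length L) ≡ 2 ℕ.^ n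
folding-length fold0 = refl
folding-length {suc n} (foldS {S = L} F s) = begin
  suc (length (bar L ++ s ∷ L))             ≡⟨ cong suc (Listₚ.length-++ (bar L)) ⟩
  suc (length (bar L)) ℕ.+ suc (length L)   ≡⟨ cong (λ m → suc m ℕ.+ suc (length L)) (length-bar L) ⟩
  suc (length L) ℕ.+ suc (length L)         ≡⟨ cong (λ m → m ℕ.+ m) (folding-length F) ⟩
  2 ℕ.^ n ℕ.+ 2 ℕ.^ n                       ≡⟨ cong (2 ℕ.^ n ℕ.+_) (ℕₚ.+-identityʳ (2 ℕ.^ n)) ⟨
  2 ℕ.^ suc n                               ∎
  where open ≡-Reasoning

2^double : ∀ n → 2 ℕ.^ double n ≡ 2 ℕ.^ n ℕ.* 2 ℕ.^ n
2^double zero    = refl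
2^double (suc n) = trans (cong (λ m → 2 ℕ.* (2 ℕ.* m)) (2^double n)) (eq (2 ℕ.^ n))
  where
  eq : ∀ m → 2 ℕ.* (2 ℕ.* (m ℕ.* m)) ≡ (2 ℕ.* m) ℕ.* (2 ℕ.* m)
  eq = solve-∀ⁿ

-- Cutting a folding word into blocks

block : List Sign → Sign → List Sign
block F plus  = F
block F minus = bar F

length-block : ∀ F b → length (block F b) ≡ length F
length-block F plus  = refl
length-block F minus = length-bar F

block-dual : ∀ {a F} → Dual a F (bar F) → ∀ b → Dual a (block F b) (block F (neg b))
block-dual D plus  = D
block-dual D minus = dual-sym D

-- The signs between the blocks are arbitrary. The kinds of the first and last block are indices
-- because two such words can be joined only if the kinds meeting at the junction differ.
data Alternating (F : List Sign) : (first last : Sign) → List Sign → Set where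
  single : ∀ b → Alternating F b b (block F b)
  cons   : ∀ b u {e L} → Alternating F (neg b) e L → Alternating F b e (block F b ++ u ∷ L)

alternating-++ : ∀ {F b e e′ L M} → Alternating F b e L → ∀ u → Alternating F (neg e) e′ M →
  Alternating F b e′ (L ++ u ∷ M)
alternating-++ (single b) u A′ = cons b u A′
alternating-++ {F} {M = M} (cons b v {L = L} A) u A′
  rewrite Listₚ.++-assoc (block F b) (v ∷ L) (u ∷ M) = cons b v (alternating-++ A u A′)

-- Reversal swaps the order of the blocks and the kind of each, so `L` and `bar L` both begin with
-- `bar F` and end with `F`. The induction carries both, since the next fold places one after the
-- other.
folding-alternating : ∀ m j {L} → Folding (suc (j ℕ.+ m)) L →
  ∃[ F ] (Folding m F × Alternating F minus plus L × Alternating F minus plus (bar L))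
folding-alternating m zero (foldS {S = F} fF s) =
  F , fF , cons minus s (single plus) ,
  subst (Alternating F minus plus) (sym (bar-fold F s)) (cons minus (neg s) (single plus))
folding-alternating m (suc j) (foldS {S = L} fL s) =
  let F , fF , A , Ā = folding-alternating m j fL
  in F , fF , alternating-++ Ā s A ,
     subst (Alternating F minus plus) (sym (bar-fold L s)) (alternating-++ Ā (neg s) A)

length-block-∷ : ∀ F b u L → length (block F b ++ u ∷ L) ≡ suc (length F) ℕ.+ length L
length-block-∷ F b u L = begin
  length (block F b ++ u ∷ L)            ≡⟨ Listₚ.length-++ (block F b) ⟩
  length (block F b) ℕ.+ suc (length L)  ≡⟨ cong (ℕ._+ suc (length L)) (length-block F b) ⟩
  length F ℕ.+ suc (length L)            ≡⟨ ℕₚ.+-suc (length F) (length L) ⟩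
  suc (length F) ℕ.+ length L            ∎
  where open ≡-Reasoning

alternating-head : ∀ {F b e L} → Alternating F b e L → ∃[ Y ] L ≡ block F b ++ Y
alternating-head {F} (single b)       = [] , sym (Listₚ.++-identityʳ (block F b))
alternating-head (cons b u {L = L} A) = u ∷ L , refl

-- The edges of a walk along L are numbered 0, …, length L; edge number c lies in the middle block of the triple.
record TripleAround (F L : List Sign) (c : ℕ) : Set where
  field
    before after   : List Sign
    kind sep₁ sep₂ : Sign
    split : L ≡ before ++ triple (block F kind) (block F (neg kind)) sep₁ sep₂ ++ after
    lower : length before ℕ.+ suc (length F) ≤ c
    upper : c < length before ℕ.+ (suc (length F) ℕ.+ suc (length F))

-- The two inequalities say that edge `c` lies neither in the first nor in the last block. First
-- blocks are stripped off until `c` lies in the second one.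
around : ∀ {F b e L} → Alternating F b e L → ∀ c →
  suc (length F) ≤ c → c ℕ.+ suc (length F) ≤ length L → TripleAround F L c
around {F} (single b) c ℓ≤c c+ℓ≤ =
  contradiction (ℕₚ.≤-trans (ℕₚ.m≤n+m (suc (length F)) c) (subst (c ℕ.+ suc (length F) ≤_) (length-block F b) c+ℓ≤))
                (ℕₚ.<-irrefl refl)
around {F} (cons b u {L = L} A) c ℓ≤c c+ℓ≤ with c ℕₚ.<? suc (length F) ℕ.+ suc (length F)
... | no c≮2ℓ = record
  { before = block F b ++ u ∷ before
  ; after  = after
  ; kind   = kind
  ; sep₁   = sep₁
  ; sep₂   = sep₂
  ; split  = trans (cong (λ M → block F b ++ u ∷ M) split) (sym (Listₚ.++-assoc (block F b) (u ∷ before) _))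
  ; lower  = begin
      length (block F b ++ u ∷ before) ℕ.+ ℓ          ≡⟨ cong (ℕ._+ ℓ) (length-block-∷ F b u before) ⟩
      ℓ ℕ.+ length before ℕ.+ ℓ                       ≡⟨ ℕₚ.+-assoc ℓ _ ℓ ⟩
      ℓ ℕ.+ (length before ℕ.+ ℓ)                     ≤⟨ ℕₚ.+-monoʳ-≤ ℓ lower ⟩
      ℓ ℕ.+ c′                                        ≡⟨ c≡ ⟩
      c                                               ∎
  ; upper  = begin-strict
      c                                               ≡⟨ c≡ ⟨
      ℓ ℕ.+ c′                                        <⟨ ℕₚ.+-monoʳ-< ℓ upper ⟩
      ℓ ℕ.+ (length before ℕ.+ (ℓ ℕ.+ ℓ))             ≡⟨ ℕₚ.+-assoc ℓ _ (ℓ ℕ.+ ℓ) ⟨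
      ℓ ℕ.+ length before ℕ.+ (ℓ ℕ.+ ℓ)               ≡⟨ cong (ℕ._+ (ℓ ℕ.+ ℓ)) (length-block-∷ F b u before) ⟨
      length (block F b ++ u ∷ before) ℕ.+ (ℓ ℕ.+ ℓ)  ∎
  }
  where
  open ℕₚ.≤-Reasoning
  ℓ  = suc (length F)
  c′ = c ℕ.∸ ℓ
  c≡ : ℓ ℕ.+ c′ ≡ c
  c≡ = ℕₚ.m+[n∸m]≡n ℓ≤c
  ℓ≤c′ : ℓ ≤ c′
  ℓ≤c′ = ℕₚ.+-cancelˡ-≤ ℓ ℓ c′ (subst (ℓ ℕ.+ ℓ ≤_) (sym c≡) (ℕₚ.≮⇒≥ c≮2ℓ))
  c′+ℓ≤ : c′ ℕ.+ ℓ ≤ length L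
  c′+ℓ≤ = ℕₚ.+-cancelˡ-≤ ℓ _ _ (begin
    ℓ ℕ.+ (c′ ℕ.+ ℓ)             ≡⟨ ℕₚ.+-assoc ℓ c′ ℓ ⟨
    ℓ ℕ.+ c′ ℕ.+ ℓ               ≡⟨ cong (ℕ._+ ℓ) c≡ ⟩
    c ℕ.+ ℓ                      ≤⟨ c+ℓ≤ ⟩
    length (block F b ++ u ∷ L)  ≡⟨ length-block-∷ F b u L ⟩
    ℓ ℕ.+ length L               ∎)
  open TripleAround (around A c′ ℓ≤c′ c′+ℓ≤)
around {F} (cons b u (single _)) c ℓ≤c c+ℓ≤ | yes _ =
  contradiction (begin
    suc (length F) ℕ.+ suc (length F)            ≤⟨ ℕₚ.+-monoˡ-≤ _ ℓ≤c ⟩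
    c ℕ.+ suc (length F)                         ≤⟨ c+ℓ≤ ⟩
    length (block F b ++ u ∷ block F (neg b))    ≡⟨ length-block-∷ F b u (block F (neg b)) ⟩
    suc (length F) ℕ.+ length (block F (neg b))  ≡⟨ cong (suc (length F) ℕ.+_) (length-block F (neg b)) ⟩
    suc (length F) ℕ.+ length F                  ∎)
    (λ 2ℓ≤ → ℕₚ.<-irrefl refl (ℕₚ.+-cancelˡ-≤ (suc (length F)) _ _ 2ℓ≤))
  where open ℕₚ.≤-Reasoning
around {F} (cons b u (cons _ v A)) c ℓ≤c c+ℓ≤ | yes c<2ℓ with alternating-head A
... | Y , refl = record
  { before = []
  ; after  = Y
  ; kind   = b
  ; sep₁   = u
  ; sep₂   = v
  ; split  = begin
      block F b ++ u ∷ (block F (neg b) ++ v ∷ (block F (neg (neg b)) ++ Y))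
        ≡⟨ cong (λ s → block F b ++ u ∷ (block F (neg b) ++ v ∷ (block F s ++ Y))) (neg-involutive b) ⟩
      block F b ++ u ∷ (block F (neg b) ++ v ∷ (block F b ++ Y))
        ≡⟨ cong (λ M → block F b ++ u ∷ M) (Listₚ.++-assoc (block F (neg b)) (v ∷ block F b) Y) ⟨
      block F b ++ u ∷ ((block F (neg b) ++ v ∷ block F b) ++ Y)
        ≡⟨ Listₚ.++-assoc (block F b) (u ∷ (block F (neg b) ++ v ∷ block F b)) Y ⟨
      triple (block F b) (block F (neg b)) u v ++ Y ∎
  ; lower  = ℓ≤c
  ; upper  = c<2ℓ
  }
  where open ≡-Reasoning

-- Windows of a curve as walks

++-split : ∀ {A : Set} (P : List A) {R} X {T} → P ++ R ≡ X ++ T → length P ≤ length X →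
  ∃[ X′ ] (X ≡ P ++ X′ × R ≡ X′ ++ T)
++-split []      X       eq _       = X , refl , eq
++-split (x ∷ P) (y ∷ X) eq (s≤s l) with Listₚ.∷-injective eq
... | refl , eq′ = let X′ , e , e′ = ++-split P X eq′ l in X′ , cong (x ∷_) e , e′

length-window : ∀ η h m → length (window η h m) ≡ m
length-window η h zero    = refl
length-window η h (suc m) = cong suc (length-window η (h ℤ.+ + 1) m)

window-prefix : ∀ η h m V {Y} → window η h m ≡ V ++ Y → V ≡ window η h (length V)
window-prefix η h m       []      eq = refl
window-prefix η h (suc m) (s ∷ V) eq with Listₚ.∷-injective eq
... | refl , eq′ = cong (s ∷_) (window-prefix η (h ℤ.+ + 1) m V eq′)

length-triple : ∀ F b u v → suc (length (triple (block F b) (block F (neg b)) u v)) ≡ 3 ℕ.* suc (length F)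
length-triple F b u v = begin
  suc (length (triple (block F b) (block F (neg b)) u v))
    ≡⟨ cong suc (length-block-∷ F b u _) ⟩
  suc (suc (length F) ℕ.+ length (block F (neg b) ++ v ∷ block F b))
    ≡⟨ cong (λ k → suc (suc (length F) ℕ.+ k)) (length-block-∷ F (neg b) v (block F b)) ⟩
  suc (suc (length F) ℕ.+ (suc (length F) ℕ.+ length (block F b)))
    ≡⟨ cong (λ k → suc (suc (length F) ℕ.+ (suc (length F) ℕ.+ k))) (length-block F b) ⟩
  suc (suc (length F) ℕ.+ (suc (length F) ℕ.+ length F))
    ≡⟨ eq (length F) ⟩
  3 ℕ.* suc (length F) ∎
  where
  open ≡-Reasoning
  eq : ∀ f → suc (suc f ℕ.+ (suc f ℕ.+ f)) ≡ 3 ℕ.* suc f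
  eq = solve-∀ⁿ

-- The catch-all clause of `turn` gives `minus` to every pair that is not a left turn;
-- perpendicularity leaves only the right turns there.
turnBy-turn : ∀ d d′ → axis d ≢ axis d′ → d′ ≡ turnBy (turn d d′) d
turnBy-turn E E p = contradiction refl p
turnBy-turn E N p = refl
turnBy-turn E W p = contradiction refl p
turnBy-turn E S p = refl
turnBy-turn N E p = refl
turnBy-turn N N p = contradiction refl p
turnBy-turn N W p = refl
turnBy-turn N S p = contradiction refl p
turnBy-turn W E p = contradiction refl p
turnBy-turn W N p = refl
turnBy-turn W W p = contradiction refl p
turnBy-turn W S p = refl
turnBy-turn S E p = refl
turnBy-turn S N p = contradiction refl p
turnBy-turn S W p = refl
turnBy-turn S S p = contradiction refl p

module _ {C : ℤ → Segment} (curve : CompleteCurve C) where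
  open CompleteCurve curve
  private η = associatedSequence C

  curve-next : ∀ i → C (i ℤ.+ + 1) ≡ next (η i) (C i)
  curve-next i = cong₂ seg (sym (connected i)) (turnBy-turn _ _ (perpendicular i))

  -- The window at `h` begins with the turn of index `h + 1`, so the walk along it begins with
  -- segment `h + 1`. Following a prefix `X` shifts both by `length X`.
  curve-run : ∀ h m X {V} → window η h m ≡ X ++ V →
    run (C (h ℤ.+ + 1)) X ≡ C (h ℤ.+ + length X ℤ.+ + 1)
      × V ≡ window η (h ℤ.+ + length X) (length V)
  curve-run h m [] refl rewrite ℤₚ.+-identityʳ h | length-window η h m = refl , refl
  curve-run h (suc m) (s ∷ X) {V} eq with Listₚ.∷-injective eq
  ... | refl , eq′ with curve-run (h ℤ.+ + 1) m X eq′
  ...   | run≡ , V≡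
        rewrite sym (curve-next (h ℤ.+ + 1)) | sym (ℤₚ.+-assoc h (+ 1) (+ length X)) = run≡ , V≡

  curve-all : ∀ {P : Segment → Set} h m → All P (segs (C (h ℤ.+ + 1)) (window η h m)) →
    ∀ j → j ≤ m → P (C (h ℤ.+ + 1 ℤ.+ + j))
  curve-all {P} h zero    (p ∷ _)  zero    _       = subst (λ i → P (C i)) (sym (ℤₚ.+-identityʳ _)) p
  curve-all {P} h (suc m) (p ∷ _)  zero    _       = subst (λ i → P (C i)) (sym (ℤₚ.+-identityʳ _)) p
  curve-all {P} h (suc m) (_ ∷ ps) (suc j) (s≤s l) =
    subst (λ i → P (C i)) (ℤₚ.+-assoc (h ℤ.+ + 1) (+ 1) (+ j))
      (curve-all (h ℤ.+ + 1) m
        (subst (λ c → All P (segs c (window η (h ℤ.+ + 1) m))) (sym (curve-next (h ℤ.+ + 1))) ps) j l)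

-- Three blocks around segment number 0

module _ {C : ℤ → Segment} (CFC : CompleteFoldingCurve C) (n : ℕ) where
  open CompleteFoldingCurve CFC
  private
    η = associatedSequence C
    ℓ = 2 ℕ.^ double n
    -- The walk along `w` runs from segment `-2ℓ` to segment `2ℓ`, so segment `0` is its edge number
    -- `2ℓ`. This leaves room for three blocks of `ℓ` segments with segment `0` in the middle one.
    h = ℤ.- (+ (ℓ ℕ.+ ℓ) ℤ.+ + 1)
    m = 4 ℕ.* ℓ
    w = window η h m

  -- The triple begins at edge number `length X` of the walk along `w`. The bounds on `length X` say
  -- exactly that edge number `2ℓ`, which is segment `0`, belongs to the middle block.
  TripleInWindow : Set
  TripleInWindow = ∃[ F ] (Folding (double n) F × ∃[ b ] ∃[ u ] ∃[ v ] ∃[ X ] ∃[ Y ]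
    (w ≡ (X ++ triple (block F b) (block F (neg b)) u v) ++ Y
      × 0 < length X × length X ≤ ℓ))

  triple-in-window : TripleInWindow
  triple-in-window with folding h m
  ... | N′ , L , fL , p , q , L≡ with double n ℕₚ.<? N′
  -- A folding word of level at most `double n` has fewer than `ℓ` signs, too few to contain the
  -- window.
  ...   | no n≮N′ = contradiction (begin-strict
            ℓ                 ≤⟨ ℕₚ.m≤m+n ℓ (3 ℕ.* ℓ) ⟩
            m                 ≡⟨ length-window η h m ⟨
            length w          ≤⟨ ℕₚ.m≤m+n (length w) (length q) ⟩
            length w ℕ.+ length q  ≤⟨ ℕₚ.m≤n+m _ (length p) ⟩
            length p ℕ.+ (length w ℕ.+ length q) ≡⟨ cong (length p ℕ.+_) (Listₚ.length-++ w) ⟨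
            length p ℕ.+ length (w ++ q) ≡⟨ Listₚ.length-++ p ⟨
            length (p ++ w ++ q) ≡⟨ cong length L≡ ⟨
            length L          <⟨ ℕₚ.n<1+n _ ⟩
            suc (length L)    ≡⟨ folding-length fL ⟩
            2 ℕ.^ N′          ≤⟨ ℕₚ.^-monoʳ-≤ 2 (ℕₚ.≮⇒≥ n≮N′) ⟩
            ℓ                 ∎) (ℕₚ.<-irrefl refl)
      where open ℕₚ.≤-Reasoning
  ...   | yes n<N′ with ℕₚ.m≤n⇒∃[o]m+o≡n n<N′
  ...     | j , refl rewrite ℕₚ.+-comm (double n) j with folding-alternating (double n) j fL
  ...       | F , fF , alt , _ = result
    where
    open ℕₚ.≤-Reasoning
    -- The position of segment `0` in the walk along all of `L`, where the window is preceded by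
    -- `p`.
    c = length p ℕ.+ (ℓ ℕ.+ ℓ)

    length-L : length L ≡ length p ℕ.+ (m ℕ.+ length q)
    length-L = begin-equality
      length L                              ≡⟨ cong length L≡ ⟩
      length (p ++ w ++ q)                  ≡⟨ Listₚ.length-++ p ⟩
      length p ℕ.+ length (w ++ q)          ≡⟨ cong (length p ℕ.+_) (Listₚ.length-++ w) ⟩
      length p ℕ.+ (length w ℕ.+ length q)  ≡⟨ cong (λ k → length p ℕ.+ (k ℕ.+ length q)) (length-window η h m) ⟩
      length p ℕ.+ (m ℕ.+ length q)         ∎

    ℓ≡ : suc (length F) ≡ ℓ
    ℓ≡ = folding-length fF

    ℓ≤c : ℓ ≤ c
    ℓ≤c = ℕₚ.≤-trans (ℕₚ.m≤m+n ℓ ℓ) (ℕₚ.m≤n+m (ℓ ℕ.+ ℓ) (length p))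

    c+ℓ≤ : c ℕ.+ ℓ ≤ length L
    c+ℓ≤ = begin
      length p ℕ.+ (ℓ ℕ.+ ℓ) ℕ.+ ℓ                       ≤⟨ ℕₚ.m≤m+n _ (ℓ ℕ.+ length q) ⟩
      length p ℕ.+ (ℓ ℕ.+ ℓ) ℕ.+ ℓ ℕ.+ (ℓ ℕ.+ length q)  ≡⟨ eq (length p) ℓ (length q) ⟩
      length p ℕ.+ (m ℕ.+ length q)                      ≡⟨ length-L ⟨
      length L                                           ∎
      where
      eq : ∀ p ℓ q → p ℕ.+ (ℓ ℕ.+ ℓ) ℕ.+ ℓ ℕ.+ (ℓ ℕ.+ q) ≡ p ℕ.+ (4 ℕ.* ℓ ℕ.+ q)
      eq = solve-∀ⁿ

    open TripleAround (around alt c (subst (_≤ c) (sym ℓ≡) ℓ≤c) (subst (λ k → c ℕ.+ k ≤ length L) (sym ℓ≡) c+ℓ≤))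

    T = triple (block F kind) (block F (neg kind)) sep₁ sep₂

    p<before : length p < length before
    p<before = ℕₚ.+-cancelʳ-< (ℓ ℕ.+ ℓ) _ _ (subst (λ k → c < length before ℕ.+ (k ℕ.+ k)) ℓ≡ upper)

    before-split = ++-split p before (trans (sym L≡) split) (ℕₚ.<⇒≤ p<before)
    X = proj₁ before-split

    length-before : length before ≡ length p ℕ.+ length X
    length-before = trans (cong length (proj₁ (proj₂ before-split))) (Listₚ.length-++ p)

    0<X : 0 < length X
    0<X = ℕₚ.+-cancelˡ-< (length p) _ _ (begin-strict
      length p ℕ.+ 0         ≡⟨ ℕₚ.+-identityʳ _ ⟩
      length p               <⟨ p<before ⟩
      length before          ≡⟨ length-before ⟩
      length p ℕ.+ length X  ∎)

    X≤ℓ : length X ≤ ℓ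
    X≤ℓ = ℕₚ.+-cancelˡ-≤ (length p) _ _ (ℕₚ.+-cancelʳ-≤ ℓ _ _ (begin
      length p ℕ.+ length X ℕ.+ ℓ       ≡⟨ cong (ℕ._+ ℓ) length-before ⟨
      length before ℕ.+ ℓ               ≡⟨ cong (length before ℕ.+_) ℓ≡ ⟨
      length before ℕ.+ suc (length F)  ≤⟨ lower ⟩
      length p ℕ.+ (ℓ ℕ.+ ℓ)            ≡⟨ ℕₚ.+-assoc (length p) ℓ ℓ ⟨
      length p ℕ.+ ℓ ℕ.+ ℓ              ∎))

    length-T : suc (length T) ≡ 3 ℕ.* ℓ
    length-T = trans (length-triple F kind sep₁ sep₂) (cong (3 ℕ.*_) ℓ≡)

    XT≤w : length (X ++ T) ≤ length w
    XT≤w = begin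
      length (X ++ T)          ≡⟨ Listₚ.length-++ X ⟩
      length X ℕ.+ length T    ≤⟨ ℕₚ.+-mono-≤ X≤ℓ (ℕₚ.≤-trans (ℕₚ.n≤1+n _) (ℕₚ.≤-reflexive length-T)) ⟩
      m                        ≡⟨ length-window η h m ⟨
      length w                 ∎

    window-split = ++-split (X ++ T) w
      (trans (Listₚ.++-assoc X T after) (sym (proj₂ (proj₂ before-split)))) XT≤w

    result : TripleInWindow
    result = F , fF , kind , sep₁ , sep₂ , X , proj₁ window-split , proj₁ (proj₂ window-split) , 0<X , X≤ℓ

  segments-near-0 : ∃[ i ] (∀ j → j < 3 ℕ.* ℓ → Near (3 ℕ.* 2 ℕ.^ n) (start (C (+ 0))) (start (C (i ℤ.+ + j))))
  segments-near-0 with triple-in-window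
  ... | F , fF , b , u , v , X , Y , w≡ , 0<X , X≤ℓ = h₁ ℤ.+ + 1 , near-all
    where
    B = block F b
    M = block F (neg b)
    T = triple B M u v
    -- The triple begins with segment `h₁ + 1` and its middle block with segment `h₂ + 1`; `j₀` is
    -- the position of segment `0` inside the middle block.
    h₁ = h ℤ.+ + length X
    h₂ = h₁ ℤ.+ + length (B ++ u ∷ [])
    j₀ = ℓ ℕ.∸ length X

    ℓ≡ : suc (length F) ≡ ℓ
    ℓ≡ = folding-length fF

    T-window : T ≡ window η h₁ (length T)
    T-window = window-prefix η h₁ _ T (sym (proj₂ (curve-run curve h m X (trans w≡ (Listₚ.++-assoc X T Y)))))

    T≡ : window η h₁ (length T) ≡ (B ++ u ∷ []) ++ (M ++ v ∷ B)
    T≡ = trans (sym T-window) (sym (Listₚ.++-assoc B (u ∷ []) (M ++ v ∷ B)))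

    M-start : run (C (h₁ ℤ.+ + 1)) (B ++ u ∷ []) ≡ C (h₂ ℤ.+ + 1)
    M-start = proj₁ (curve-run curve h₁ _ (B ++ u ∷ []) T≡)

    M-window : M ≡ window η h₂ (length M)
    M-window = window-prefix η h₂ _ M (sym (proj₂ (curve-run curve h₁ _ (B ++ u ∷ []) T≡)))

    length-Bu : length (B ++ u ∷ []) ≡ ℓ
    length-Bu = trans (length-block-∷ F b u []) (trans (ℕₚ.+-identityʳ _) ℓ≡)

    X+j₀ : length X ℕ.+ j₀ ≡ ℓ
    X+j₀ = ℕₚ.m+[n∸m]≡n X≤ℓ

    j₀≤M : j₀ ≤ length M
    j₀≤M = ℕ.s≤s⁻¹ (begin
      suc j₀             ≤⟨ ℕₚ.+-monoˡ-≤ j₀ 0<X ⟩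
      length X ℕ.+ j₀    ≡⟨ X+j₀ ⟩
      ℓ                  ≡⟨ ℓ≡ ⟨
      suc (length F)     ≡⟨ cong suc (length-block F (neg b)) ⟨
      suc (length M)     ∎)
      where open ℕₚ.≤-Reasoning

    centre : h₂ ℤ.+ + 1 ℤ.+ + j₀ ≡ + 0
    centre = lemma X+j₀ length-Bu
      where
      eq : ∀ x j → ℤ.- ((x ℤ.+ j) ℤ.+ (x ℤ.+ j) ℤ.+ + 1) ℤ.+ x ℤ.+ (x ℤ.+ j) ℤ.+ + 1 ℤ.+ j ≡ + 0
      eq = solve-∀
      lemma : ∀ {x j l k} → x ℕ.+ j ≡ l → k ≡ l →
        ℤ.- (+ (l ℕ.+ l) ℤ.+ + 1) ℤ.+ + x ℤ.+ + k ℤ.+ + 1 ℤ.+ + j ≡ + 0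
      lemma {x} {j} refl refl = eq (+ x) (+ j)

    D : Dual (2 ℕ.^ n) B M
    D = block-dual (folding-dual n fF) b

    NearT : Segment → Set
    NearT p = All (λ q → Near (3 ℕ.* 2 ℕ.^ n) (start p) (start q)) (segs (C (h₁ ℤ.+ + 1)) (window η h₁ (length T)))

    near-M : All NearT (segs (C (h₂ ℤ.+ + 1)) (window η h₂ (length M)))
    near-M = subst (λ V → All NearT (segs (C (h₂ ℤ.+ + 1)) V)) M-window
      (subst (λ c → All NearT (segs c M)) M-start
        (subst (λ V → All (λ p → All (λ q → Near (3 ℕ.* 2 ℕ.^ n) (start p) (start q)) (segs (C (h₁ ℤ.+ + 1)) V))
                          (segs (run (C (h₁ ℤ.+ + 1)) (B ++ u ∷ [])) M)) T-window
          (triple-near D (C (h₁ ℤ.+ + 1)) u v)))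

    near-0 : NearT (C (+ 0))
    near-0 = subst (λ i → NearT (C i)) centre (curve-all curve h₂ (length M) near-M j₀ j₀≤M)

    near-all : ∀ j → j < 3 ℕ.* ℓ → Near (3 ℕ.* 2 ℕ.^ n) (start (C (+ 0))) (start (C (h₁ ℤ.+ + 1 ℤ.+ + j)))
    near-all j j< = curve-all curve h₁ (length T) near-0 j (ℕ.s≤s⁻¹ (subst (j <_) (sym length-T) j<))
      where
      length-T : suc (length T) ≡ 3 ℕ.* ℓ
      length-T = trans (length-triple F b u v) (cong (3 ℕ.*_) ℓ≡)

-- Counting edges

bounded : ∀ k (f : Fin k → ℕ) → ∃[ B ] (∀ a → f a ≤ B)
bounded zero    f = 0 , λ ()
bounded (suc k) f with bounded k (λ a → f (Fin.suc a))
... | B , f≤B = f Fin.zero ℕ.⊔ B , λ where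
  Fin.zero    → ℕₚ.m≤m⊔n _ B
  (Fin.suc a) → ℕₚ.≤-trans (f≤B a) (ℕₚ.m≤n⊔m (f Fin.zero) B)

Edge : Set
Edge = Point × Axis

-- For `W` and `S` the support is recorded by the terminal point, one unit away from the start.
support-near : ∀ c → Near 1 (proj₁ (support c)) (start c)
support-near (seg p E) = near-refl 1 p
support-near (seg p N) = near-refl 1 p
support-near (seg p W) = near-move 1 W p
support-near (seg p S) = near-move 1 S p

origin : Point
origin = + 0 , + 0

-- Translation by `K` makes the coordinate nonnegative, so passing to the absolute value loses
-- nothing.
shifted : ∀ K x → ∣ x ℤ.- + 0 ∣ ≤ K → + ∣ x ℤ.+ + K ∣ ≡ x ℤ.+ + K
shifted K x x≤K = ℤₚ.0≤i⇒+∣i∣≡i (lemma x (subst (_≤ K) (cong ∣_∣ (ℤₚ.+-identityʳ x)) x≤K))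
  where
  lemma : ∀ x → ∣ x ∣ ≤ K → + 0 ℤ.≤ x ℤ.+ + K
  lemma (+ n)        _   = ℤ.+≤+ z≤n
  lemma (ℤ.-[1+ n ]) n<K = subst (+ 0 ℤ.≤_) (sym (ℤₚ.⊖-≥ n<K)) (ℤ.+≤+ z≤n)

coordinate : ∀ K x → ∣ x ℤ.- + 0 ∣ ≤ K → Fin (suc (K ℕ.+ K))
coordinate K x x≤K = fromℕ< {∣ x ℤ.+ + K ∣} (s≤s (ℕₚ.≤-trans (ℤₚ.∣i+j∣≤∣i∣+∣j∣ x (+ K))
  (ℕₚ.+-monoˡ-≤ K (subst (_≤ K) (cong ∣_∣ (ℤₚ.+-identityʳ x)) x≤K))))

coordinate-injective : ∀ K x y p q → coordinate K x p ≡ coordinate K y q → x ≡ y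
coordinate-injective K x y p q eq = +-Group.∙-cancelʳ (+ K) x y (begin
  x ℤ.+ + K          ≡⟨ shifted K x p ⟨
  + ∣ x ℤ.+ + K ∣    ≡⟨ cong +_ (Finₚ.fromℕ<-injective _ _ _ _ eq) ⟩
  + ∣ y ℤ.+ + K ∣    ≡⟨ shifted K y q ⟩
  y ℤ.+ + K          ∎)
  where open ≡-Reasoning

axisIndex : Axis → Fin 2
axisIndex horiz = Fin.zero
axisIndex vert  = Fin.suc Fin.zero

axisIndex-injective : ∀ {α β} → axisIndex α ≡ axisIndex β → α ≡ β
axisIndex-injective {horiz} {horiz} _ = refl
axisIndex-injective {vert}  {vert}  _ = refl

edgeIndex : ∀ K (ε : Edge) → Near K (proj₁ ε) origin → Fin (2 ℕ.* (suc (K ℕ.+ K) ℕ.* suc (K ℕ.+ K)))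
edgeIndex K ((x , y) , α) (near h v) = combine (axisIndex α) (combine (coordinate K x h) (coordinate K y v))

edgeIndex-injective : ∀ K ε δ p q → edgeIndex K ε p ≡ edgeIndex K δ q → ε ≡ δ
edgeIndex-injective K ((x , y) , α) ((x′ , y′) , β) (near h v) (near h′ v′) eq =
  let eqα , eqp = Finₚ.combine-injective (axisIndex α) _ (axisIndex β) _ eq
      eqx , eqy = Finₚ.combine-injective (coordinate K x h) _ (coordinate K x′ h′) _ eqp
  in cong₂ _,_ (cong₂ _,_ (coordinate-injective K x x′ h h′ eqx) (coordinate-injective K y y′ v v′ eqy))
               (axisIndex-injective eqα)

-- Pigeonhole: each coordinate of the recorded endpoint takes `2K + 1` values, and there are two
-- axes.
edges-in-box : ∀ {m} K (f : Fin m → Edge) → (∀ i → Near K (proj₁ (f i)) origin) →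
  (∀ {i j} → f i ≡ f j → i ≡ j) → m ≤ 2 ℕ.* (suc (K ℕ.+ K) ℕ.* suc (K ℕ.+ K))
edges-in-box K f f-near f-inj = Finₚ.injective⇒≤ {f = λ i → edgeIndex K (f i) (f-near i)}
  (λ {i} {j} eq → f-inj (edgeIndex-injective K (f i) (f j) (f-near i) (f-near j) eq))

n<2^n : ∀ n → n < 2 ℕ.^ n
n<2^n zero    = s≤s z≤n
n<2^n (suc n) = ℕₚ.+-mono-≤ (ℕₚ.m^n>0 2 n) (ℕₚ.≤-trans (n<2^n n) (ℕₚ.m≤m+n (2 ℕ.^ n) 0))

-- The leading terms are `3k a²` and `72 a²`. If `k` were at least 25, a surplus of `3 a²` would
-- have to fit into `24 a c + 2 c²`, which is less than `27 a c` and so less than `3 a²`.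
quadratic-bound : ∀ k a c → 0 < c → 9 ℕ.* c ≤ a →
  k ℕ.* (3 ℕ.* (a ℕ.* a)) ≤ 2 ℕ.* ((6 ℕ.* a ℕ.+ c) ℕ.* (6 ℕ.* a ℕ.+ c)) → k ≤ 24
quadratic-bound k a c 0<c 9c≤a bound with k ℕₚ.≤? 24
... | yes k≤24 = k≤24
... | no  k≰24 = contradiction (begin-strict
  25 ℕ.* (3 ℕ.* (a ℕ.* a))                                        ≤⟨ ℕₚ.*-monoˡ-≤ (3 ℕ.* (a ℕ.* a)) (ℕₚ.≰⇒> k≰24) ⟩
  k ℕ.* (3 ℕ.* (a ℕ.* a))                                         ≤⟨ bound ⟩
  2 ℕ.* ((6 ℕ.* a ℕ.+ c) ℕ.* (6 ℕ.* a ℕ.+ c))                     ≡⟨ eq₁ a c ⟩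
  72 ℕ.* (a ℕ.* a) ℕ.+ (24 ℕ.* (a ℕ.* c) ℕ.+ 2 ℕ.* (c ℕ.* c))     <⟨ ℕₚ.+-monoʳ-< (72 ℕ.* (a ℕ.* a)) (ℕₚ.+-monoʳ-< (24 ℕ.* (a ℕ.* c)) 2c²<3ac) ⟩
  72 ℕ.* (a ℕ.* a) ℕ.+ (24 ℕ.* (a ℕ.* c) ℕ.+ 3 ℕ.* (a ℕ.* c))     ≡⟨ cong (72 ℕ.* (a ℕ.* a) ℕ.+_) (eq₂ a c) ⟩
  72 ℕ.* (a ℕ.* a) ℕ.+ 3 ℕ.* (a ℕ.* (9 ℕ.* c))                    ≤⟨ ℕₚ.+-monoʳ-≤ (72 ℕ.* (a ℕ.* a)) (ℕₚ.*-monoʳ-≤ 3 (ℕₚ.*-monoʳ-≤ a 9c≤a)) ⟩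
  72 ℕ.* (a ℕ.* a) ℕ.+ 3 ℕ.* (a ℕ.* a)                            ≡⟨ eq₃ a ⟩
  25 ℕ.* (3 ℕ.* (a ℕ.* a))                                        ∎) (ℕₚ.<-irrefl refl)
  where
  open ℕₚ.≤-Reasoning
  eq₁ : ∀ a c → 2 ℕ.* ((6 ℕ.* a ℕ.+ c) ℕ.* (6 ℕ.* a ℕ.+ c)) ≡ 72 ℕ.* (a ℕ.* a) ℕ.+ (24 ℕ.* (a ℕ.* c) ℕ.+ 2 ℕ.* (c ℕ.* c))
  eq₁ = solve-∀ⁿ
  eq₂ : ∀ a c → 24 ℕ.* (a ℕ.* c) ℕ.+ 3 ℕ.* (a ℕ.* c) ≡ 3 ℕ.* (a ℕ.* (9 ℕ.* c))
  eq₂ = solve-∀ⁿ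
  eq₃ : ∀ a → 72 ℕ.* (a ℕ.* a) ℕ.+ 3 ℕ.* (a ℕ.* a) ≡ 25 ℕ.* (3 ℕ.* (a ℕ.* a))
  eq₃ = solve-∀ⁿ
  c≤a : c ≤ a
  c≤a = ℕₚ.≤-trans (ℕₚ.m≤m+n c (8 ℕ.* c)) 9c≤a
  2c²<3ac : 2 ℕ.* (c ℕ.* c) < 3 ℕ.* (a ℕ.* c)
  2c²<3ac = ℕₚ.<-≤-trans (ℕₚ.*-monoˡ-< (c ℕ.* c) {{ℕ.>-nonZero (ℕₚ.*-mono-≤ 0<c 0<c)}} (ℕₚ.n<1+n 2))
    (ℕₚ.*-monoʳ-≤ 3 (ℕₚ.*-monoˡ-≤ c c≤a))

theorem3p16 : (k : ℕ) → (C : Fin k → ℤ → Segment)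
    → (∀ a → CompleteFoldingCurve (C a))
    → (∀ a b → a ≢ b → Disjoint (C a) (C b))
    → k ≤ 24
theorem3p16 k C folding disjoint = quadratic-bound k (2 ℕ.^ n) c (s≤s z≤n) (ℕₚ.<⇒≤ (n<2^n n)) (begin
  k ℕ.* (3 ℕ.* (2 ℕ.^ n ℕ.* 2 ℕ.^ n))                  ≡⟨ cong (λ l → k ℕ.* (3 ℕ.* l)) (2^double n) ⟨
  k ℕ.* ℓ                                              ≤⟨ edges-in-box K edge edge-near edge-injective ⟩
  2 ℕ.* (suc (K ℕ.+ K) ℕ.* suc (K ℕ.+ K))              ≡⟨ cong (λ l → 2 ℕ.* (l ℕ.* l)) (side (2 ℕ.^ n) R) ⟩
  2 ℕ.* ((6 ℕ.* 2 ℕ.^ n ℕ.+ c) ℕ.* (6 ℕ.* 2 ℕ.^ n ℕ.+ c)) ∎)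
  where
  open ℕₚ.≤-Reasoning hiding (start)

  origin-bound : ∃[ R ] (∀ a → ∣ proj₁ (start (C a (+ 0))) ∣ ℕ.⊔ ∣ proj₂ (start (C a (+ 0))) ∣ ≤ R)
  origin-bound = bounded k (λ a → ∣ proj₁ (start (C a (+ 0))) ∣ ℕ.⊔ ∣ proj₂ (start (C a (+ 0))) ∣)

  R = proj₁ origin-bound
  -- The part of the side `2K + 1` that does not grow with `n`. The next line makes `n` so large
  -- that `9 c` is below `2 ^ n`.
  c = suc (R ℕ.+ R ℕ.+ 2)
  n = 9 ℕ.* c
  ℓ = 3 ℕ.* 2 ℕ.^ double n
  -- One unit from the support to the start of its segment, `3 * 2 ^ n` from there to the start of
  -- segment `0`, and `R` from there to the origin.
  K = 1 ℕ.+ (3 ℕ.* 2 ℕ.^ n ℕ.+ R)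

  side : ∀ a R → suc ((1 ℕ.+ (3 ℕ.* a ℕ.+ R)) ℕ.+ (1 ℕ.+ (3 ℕ.* a ℕ.+ R))) ≡ 6 ℕ.* a ℕ.+ suc (R ℕ.+ R ℕ.+ 2)
  side = solve-∀ⁿ

  near-origin : ∀ a → Near R (start (C a (+ 0))) origin
  near-origin a = near
    (subst (_≤ R) (cong ∣_∣ (sym (ℤₚ.+-identityʳ x))) (ℕₚ.m⊔n≤o⇒m≤o ∣ x ∣ ∣ y ∣ (proj₂ origin-bound a)))
    (subst (_≤ R) (cong ∣_∣ (sym (ℤₚ.+-identityʳ y))) (ℕₚ.m⊔n≤o⇒n≤o ∣ x ∣ ∣ y ∣ (proj₂ origin-bound a)))
    where
    x = proj₁ (start (C a (+ 0)))
    y = proj₂ (start (C a (+ 0)))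

  base : Fin k → ℤ
  base a = proj₁ (segments-near-0 (folding a) n)

  segment : Fin k → Fin ℓ → Segment
  segment a j = C a (base a ℤ.+ + toℕ j)

  segment-near : ∀ a j → Near K (proj₁ (support (segment a j))) origin
  segment-near a j = near-trans (support-near (segment a j))
    (near-trans (near-sym (proj₂ (segments-near-0 (folding a) n) (toℕ j) (Finₚ.toℕ<n j))) (near-origin a))

  segment-injective : ∀ a j b l → support (segment a j) ≡ support (segment b l) → (a , j) ≡ (b , l)
  segment-injective a j b l eq with a Finₚ.≟ b
  ... | no  a≢b  = contradiction eq (disjoint a b a≢b _ _)
  ... | yes refl with j Finₚ.≟ l
  ...   | yes refl = refl
  ...   | no  j≢l  = contradiction eq (CompleteCurve.supportsDistinct (CompleteFoldingCurve.curve (folding a)) _ _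
            (λ same → j≢l (Finₚ.toℕ-injective (ℤₚ.+-injective (+-Group.∙-cancelˡ (base a) _ _ same)))))

  edge : Fin (k ℕ.* ℓ) → Edge
  edge i = let a , j = remQuot ℓ i in support (segment a j)

  edge-near : ∀ i → Near K (proj₁ (edge i)) origin
  edge-near i = let a , j = remQuot ℓ i in segment-near a j

  edge-injective : ∀ {i i′} → edge i ≡ edge i′ → i ≡ i′
  edge-injective {i} {i′} eq = trans (sym (Finₚ.combine-remQuot {k} ℓ i))
    (trans (cong (uncurry combine) (segment-injective _ _ _ _ eq)) (Finₚ.combine-remQuot {k} ℓ i′))
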